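{- Let $\mathbf B$ be a finite many-sorted relational structure with a balanced realization $(\pi_s,\mu_R)$, let $\mathbf X$ be a finite instance, and let $e_{\mathbf X}$ be its balanced occurrence lift. Then $\mathrm{NCF}(e_{\mathbf X})$ is the optimal value of the linear program $$\max \sum_{h\in\mathrm{Hom}(\mathbf X,\mathbf B)} w_h$$ subject to $$\sum_{h:\,h(c)=\mathbf b} w_h\le \mu_R(\mathbf b)\quad\text{for every constraint } c=(R,\mathbf x)\text{ of }\mathbf X\text{ and every }\mathbf b\in R^{\mathbf B},\qquad w_h\ge 0 .$$ The inequalities coming from the consistency contexts, and the singleton-capacity inequalities $\sum_{h:\,h(x)=a}w_h\le\pi_s(a)$ (for $x$ a variable of sort $s$ and $a\in B_s$), are redundant. The dual of this linear program is $$\min \sum_{c=(R,\mathbf x)}\ \sum_{\mathbf b\in R^{\mathbf B}}\mu_R(\mathbf b)\,y_{c,\mathbf b}$$ subject to $$\sum_{c} y_{c,h(c)}\ge 1\quad\text{for every }h\in\mathrm{Hom}(\mathbf X,\mathbf B),\qquad y_{c,\mathbf b}\ge 0 .$$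
   Context: $\mathcal D(S)$ denotes the set of probability distributions on a finite set $S$. $\mathbf B$ is a finite relational structure with sorts $s$ and finite domains $B_s$; a relation symbol $R$ of sort signature $(s_1,\dots,s_r)$ is interpreted by $R^{\mathbf B}\subseteq B_{s_1}\times\cdots\times B_{s_r}$. A balanced realization consists of full-support distributions $\pi_s\in\mathcal D(B_s)$ and, for each $R$, a distribution $\mu_R\in\mathcal D(R^{\mathbf B})$ with support exactly $R^{\mathbf B}$ whose $j$th marginal is $\pi_{s_j}$ for each $j$. An instance $\mathbf X$ has finitely many variables, each with a sort, and finitely many constraint occurrences $c=(R,(x_1,\dots,x_r))$ respecting sorts; isolated variables (in no constraint) are deleted. $\mathrm{Hom}(\mathbf X,\mathbf B)$ is the set of sort-preserving assignments $h$ of domain values to variables such that $h(c):=(h(x_1),\dots,h(x_r))\in R^{\mathbf B}$ for every constraint $c=(R,(x_1,\dots,x_r))$. The balanced occurrence lift $e_{\mathbf X}$ is the following empirical model. Observables: one central observable for each variable $x$ (outcomes in $B_s$, $s$ the sort of $x$), and, for every constraint $c$ and every position $j$ of its scope, a fresh observable $x_j^c$ (outcomes in $B_{s_j}$). Contexts and tables: for each $c=(R,\mathbf x)$ the occurrence context $(x_1^c,\dots,x_r^c)$ with table $\mu_R$ (zero off $R^{\mathbf B}$), and for each $c,j$ the consistency context $(x_j,x_j^c)$ with table $(a,b)\mapsto\pi_{s_j}(a)$ if $a=b$ and $0$ otherwise. For a finite empirical model $e$ with tables $e_C$, the noncontextual fraction is $\mathrm{NCF}(e)=\max\{\sum_g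 b_g:\ \sum_{g:\,g|_C=u}b_g\le e_C(u)\text{ for all contexts }C\text{ and local outcomes }u,\ b_g\ge0\}$, where $g$ ranges over all global assignments of outcomes to observables. -}

module Defs where

open import Algebra.Bundles using (CommutativeRing)
open import Data.Bool.Base using (if_then_else_)
open import Data.Empty using (⊥-elim-irr)
open import Data.Fin.Base using (Fin; zero; suc)
import Data.Fin.Properties as Fin
open import Data.Irrelevant using ([_])
open import Data.List.Base as List using (List; []; _∷_; foldr; filter; allFin; cartesianProductWith; _++_)
import Data.List.Properties as List
open import Data.List.Membership.Propositional using (_∈_)
open import Data.List.Membership.Propositional.Properties
  using (∈-map⁺; ∈-map⁻; ∈-++⁻; ∈-++⁺ˡ; ∈-++⁺ʳ; ∈-allFin; ∈-cartesianProductWith⁺)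
open import Data.List.Relation.Unary.All as All using (All; []; _∷_)
open import Data.List.Relation.Unary.AllPairs using ([]; _∷_)
open import Data.List.Relation.Unary.Any using (here; there)
open import Data.List.Relation.Unary.Unique.Propositional using (Unique)
open import Data.List.Relation.Unary.Unique.Propositional.Properties
  using (map⁺; ++⁺; allFin⁺; cartesianProductWith⁺; Unique[x∷xs]⇒x∉xs)
open import Data.Nat.Base using (ℕ)
open import Data.Product.Base using (Σ; ∃; _×_; _,_; proj₁; proj₂)
import Data.Product.Properties as Product
open import Data.Refinement as Refinement using (Refinement; value; _,_)
open import Data.Sum.Base using (_⊎_; inj₁; inj₂)
import Data.Sum.Properties as Sum
open import Function.Base using (_∘_)
open import Function.Bundles using (_⇔_)
open import Level using (Level; 0ℓ; _⊔_) renaming (suc to lsuc)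
open import Relation.Binary.Definitions using (DecidableEquality)
open import Relation.Binary.PropositionalEquality using (_≡_; refl; cong)
open import Relation.Binary.Structures using (IsTotalOrder)
open import Relation.Nullary using (¬_; does; yes; no)
open import Relation.Nullary.Decidable using (_×-dec_; map′)
open import Relation.Unary using (Pred; Decidable)

------------------------------------------------------------------------
-- Finite sets

-- The duplicate-free enumeration is what sums run over.
record FiniteSet : Set₁ where
  field
    ∣_∣      : Set
    _≟_      : DecidableEquality ∣_∣
    elements : List ∣_∣
    complete : ∀ x → x ∈ elements
    unique   : Unique elements

open FiniteSet public using (∣_∣; elements; complete; unique)

open FiniteSet using (_≟_)

infix 4 ≟-syntax
≟-syntax : (A : FiniteSet) → DecidableEquality ∣ A ∣
≟-syntax = _≟_
syntax ≟-syntax A x y = x ≟[ A ] y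

Finᶠ : ℕ → FiniteSet
Finᶠ n = record
  { ∣_∣ = Fin n ; _≟_ = Fin._≟_ ; elements = allFin n
  ; complete = ∈-allFin ; unique = allFin⁺ n }

infixr 1 _⊎ᶠ_
_⊎ᶠ_ : FiniteSet → FiniteSet → FiniteSet
A ⊎ᶠ B = record
  { ∣_∣ = ∣ A ∣ ⊎ ∣ B ∣
  ; _≟_ = Sum.≡-dec (_≟_ A) (_≟_ B)
  ; elements = List.map inj₁ (elements A) ++ List.map inj₂ (elements B)
  ; complete = λ where
      (inj₁ a) → ∈-++⁺ˡ (∈-map⁺ inj₁ (complete A a))
      (inj₂ b) → ∈-++⁺ʳ _ (∈-map⁺ inj₂ (complete B b))
  ; unique = ++⁺ (map⁺ (λ { refl → refl }) (unique A))
                 (map⁺ (λ { refl → refl }) (unique B))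
                 disjoint
  }
  where
  disjoint : ∀ {v} → ¬ (v ∈ List.map inj₁ (elements A) × v ∈ List.map inj₂ (elements B))
  disjoint (p , q) with ∈-map⁻ inj₁ p | ∈-map⁻ inj₂ q
  ... | _ , _ , refl | _ , _ , ()

module _ (A : FiniteSet) (B : ∣ A ∣ → FiniteSet) where

  pairs : List ∣ A ∣ → List (Σ ∣ A ∣ (∣_∣ ∘ B))
  pairs []       = []
  pairs (x ∷ xs) = List.map (x ,_) (elements (B x)) ++ pairs xs

  pairs-complete : ∀ {x xs} (y : ∣ B x ∣) → x ∈ xs → (x , y) ∈ pairs xs
  pairs-complete {x} y (here refl) = ∈-++⁺ˡ (∈-map⁺ (x ,_) (complete (B x) y))
  pairs-complete y (there p)       = ∈-++⁺ʳ _ (pairs-complete y p)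

  ∈-pairs : ∀ xs {x y} → (x , y) ∈ pairs xs → x ∈ xs
  ∈-pairs (x ∷ xs) p with ∈-++⁻ (List.map (x ,_) (elements (B x))) p
  ... | inj₂ q = there (∈-pairs xs q)
  ... | inj₁ q with ∈-map⁻ (x ,_) q
  ...   | _ , _ , refl = here refl

  pairs-unique : ∀ {xs} → Unique xs → Unique (pairs xs)
  pairs-unique []                    = []
  pairs-unique {x ∷ xs} xs!@(_ ∷ u) =
    ++⁺ (map⁺ (λ { refl → refl }) (unique (B x))) (pairs-unique u) disjoint
    where
    disjoint : ∀ {v} → ¬ (v ∈ List.map (x ,_) (elements (B x)) × v ∈ pairs xs)
    disjoint (p , q) with ∈-map⁻ (x ,_) p
    ... | _ , _ , refl = Unique[x∷xs]⇒x∉xs xs! (∈-pairs xs q)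

  Σᶠ : FiniteSet
  Σᶠ = record
    { ∣_∣ = Σ ∣ A ∣ (∣_∣ ∘ B)
    ; _≟_ = Product.≡-dec (_≟_ A) (λ {x} → _≟_ (B x))
    ; elements = pairs (elements A)
    ; complete = λ (x , y) → pairs-complete y (complete A x)
    ; unique = pairs-unique (unique A)
    }

-- Dependent functions on a finite set, stored as their table of values so
-- that pointwise equal functions are propositionally equal.
record Π (A : FiniteSet) (B : ∣ A ∣ → FiniteSet) : Set where
  constructor table
  field
    values : All (∣_∣ ∘ B) (elements A)

  infixl 9 _$_
  _$_ : ∀ x → ∣ B x ∣
  _$_ x = All.lookup values (complete A x)

open Π public

tabulate : {A : FiniteSet} {B : ∣ A ∣ → FiniteSet} → (∀ x → ∣ B x ∣) → Π A B
tabulate f = table (All.tabulate (λ {x} _ → f x))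

module _ (A : FiniteSet) (B : ∣ A ∣ → FiniteSet) where

  Row : List ∣ A ∣ → Set
  Row = All (∣_∣ ∘ B)

  ∷-injective : ∀ {x xs} {y y′ : ∣ B x ∣} {r r′ : Row xs} →
                _≡_ {A = Row (x ∷ xs)} (y ∷ r) (y′ ∷ r′) → y ≡ y′ × r ≡ r′
  ∷-injective refl = refl , refl

  rows : ∀ xs → List (Row xs)
  rows []       = [] ∷ []
  rows (x ∷ xs) = cartesianProductWith _∷_ (elements (B x)) (rows xs)

  rows-complete : ∀ {xs} (r : Row xs) → r ∈ rows xs
  rows-complete []      = here refl
  rows-complete (y ∷ r) = ∈-cartesianProductWith⁺ _∷_ (complete (B _) y) (rows-complete r)

  rows-unique : ∀ xs → Unique (rows xs)
  rows-unique []       = [] ∷ []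
  rows-unique (x ∷ xs) = cartesianProductWith⁺ _∷_ ∷-injective (unique (B x)) (rows-unique xs)

  row-≟ : ∀ {xs} → DecidableEquality (Row xs)
  row-≟ []      []        = yes refl
  row-≟ (y ∷ r) (y′ ∷ r′) =
    map′ (λ { (refl , refl) → refl }) ∷-injective (_≟_ (B _) y y′ ×-dec row-≟ r r′)

  Πᶠ : FiniteSet
  Πᶠ = record
    { ∣_∣ = Π A B
    ; _≟_ = λ f g → map′ (cong table) (cong values) (row-≟ (values f) (values g))
    ; elements = List.map table (rows (elements A))
    ; complete = λ f → ∈-map⁺ table (rows-complete (values f))
    ; unique = map⁺ (cong values) (rows-unique (elements A))
    }

module _ (A : FiniteSet) {P : Pred ∣ A ∣ 0ℓ} (P? : Decidable P) where

  select : List ∣ A ∣ → List (Refinement ∣ A ∣ P)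
  select []       = []
  select (x ∷ xs) with P? x
  ... | yes p = (x , [ p ]) ∷ select xs
  ... | no _  = select xs

  select-complete : ∀ {xs} (x : Refinement ∣ A ∣ P) → value x ∈ xs → x ∈ select xs
  select-complete {y ∷ xs} (x , [ p ]) (here refl) with P? y
  ... | yes _ = here refl
  ... | no ¬p = ⊥-elim-irr (¬p p)
  select-complete {y ∷ xs} x (there q) with P? y
  ... | yes _ = there (select-complete x q)
  ... | no _  = select-complete x q

  ∈-select : ∀ xs {x} → x ∈ select xs → value x ∈ xs
  ∈-select (y ∷ xs) q with P? y
  ∈-select (y ∷ xs) (here refl) | yes _ = here refl
  ∈-select (y ∷ xs) (there q)   | yes _ = there (∈-select xs q)
  ∈-select (y ∷ xs) q           | no _  = there (∈-select xs q)

  select-unique : ∀ {xs} → Unique xs → Unique (select xs)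
  select-unique []                   = []
  select-unique {x ∷ xs} xs!@(_ ∷ u) with P? x
  ... | yes _ = All.tabulate (λ { q refl → Unique[x∷xs]⇒x∉xs xs! (∈-select xs q) }) ∷ select-unique u
  ... | no _  = select-unique u

  subset : FiniteSet
  subset = record
    { ∣_∣ = Refinement ∣ A ∣ P
    ; _≟_ = Refinement._≟_ (_≟_ A)
    ; elements = select (elements A)
    ; complete = λ x → select-complete x (complete A (value x))
    ; unique = select-unique (unique A)
    }

------------------------------------------------------------------------
-- Ordered fields

-- Probabilities and linear programs take values in an arbitrary ordered
-- field; the real numbers are the intended instance.
record OrderedField (c ℓ₁ ℓ₂ : Level) : Set (lsuc (c ⊔ ℓ₁ ⊔ ℓ₂)) where
  infix 4 _≤_ _<_
  field
    commutativeRing : CommutativeRing c ℓ₁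
  open CommutativeRing commutativeRing public
  field
    _≤_          : Carrier → Carrier → Set ℓ₂
    isTotalOrder : IsTotalOrder _≈_ _≤_
    0≉1          : ¬ 0# ≈ 1#
    inverse      : ∀ x → ¬ x ≈ 0# → ∃ λ y → x * y ≈ 1#
    +-monoˡ-≤    : ∀ z {x y} → x ≤ y → x + z ≤ y + z
    *-nonNeg     : ∀ {x y} → 0# ≤ x → 0# ≤ y → 0# ≤ x * y

  _<_ : Carrier → Carrier → Set (ℓ₁ ⊔ ℓ₂)
  x < y = x ≤ y × ¬ x ≈ y

------------------------------------------------------------------------
-- Relational structures and instances

record Structure : Set₁ where
  field
    Sort   : FiniteSet
    Domain : ∣ Sort ∣ → FiniteSet
    Symbol : FiniteSet
    arity  : ∣ Symbol ∣ → ℕ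
    sig    : ∀ R → Fin (arity R) → ∣ Sort ∣
    Holds  : ∀ R → Pred (Π (Finᶠ (arity R)) (λ j → Domain (sig R j))) 0ℓ
    holds? : ∀ R → Decidable (Holds R)

  Tuple : ∣ Symbol ∣ → FiniteSet
  Tuple R = Πᶠ (Finᶠ (arity R)) (λ j → Domain (sig R j))

  Rel : ∣ Symbol ∣ → FiniteSet
  Rel R = subset (Tuple R) (holds? R)

record Instance (𝐁 : Structure) : Set₁ where
  open Structure 𝐁
  field
    -- The variables of each sort; indexing by sorts makes scopes respect them.
    Var : ∣ Sort ∣ → FiniteSet

  Variable : FiniteSet
  Variable = Σᶠ Sort Var

  field
    Constraint  : FiniteSet
    rel         : ∣ Constraint ∣ → ∣ Symbol ∣
    scope       : ∀ c j → ∣ Var (sig (rel c) j) ∣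
    -- Isolated variables have been deleted.
    nonIsolated : ∀ (x : ∣ Variable ∣) → ∃ λ c → ∃ λ j → (sig (rel c) j , scope c j) ≡ x

  Assignment : FiniteSet
  Assignment = Πᶠ Variable (λ (s , _) → Domain s)

  image : ∣ Assignment ∣ → ∀ c → ∣ Tuple (rel c) ∣
  image h c = tabulate (λ j → h $ (_ , scope c j))

  IsHom : Pred ∣ Assignment ∣ 0ℓ
  IsHom h = ∀ (c : ∣ Constraint ∣) → Holds (rel c) (image h c)

  isHom? : Decidable IsHom
  isHom? h = map′ (λ hs c → All.lookup hs (complete Constraint c))
                  (λ hom → All.tabulate (λ {c} _ → hom c))
                  (All.all? (λ c → holds? (rel c) (image h c)) (elements Constraint))

  Hom : FiniteSet
  Hom = subset Assignment isHom?

  infixl 9 _⟨_⟩ _⟪_⟫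
  _⟨_⟩ : ∣ Hom ∣ → ∀ {s} (x : ∣ Var s ∣) → ∣ Domain s ∣
  h ⟨ x ⟩ = value h $ (_ , x)

  _⟪_⟫ : ∣ Hom ∣ → ∀ c → ∣ Rel (rel c) ∣
  h ⟪ c ⟫ = Refinement.map (λ a → image a c) (λ hom → hom c) h

module Over {c ℓ₁ ℓ₂} (K : OrderedField c ℓ₁ ℓ₂) where
  open OrderedField K using (Carrier; _≈_; _≤_; _<_; _+_; _*_; 0#; 1#)

------------------------------------------------------------------------
-- Sums and distributions

  ∑ : (A : FiniteSet) → (∣ A ∣ → Carrier) → Carrier
  ∑ A f = foldr (λ x s → f x + s) 0# (elements A)

  ∑[_∣_]_ : (A : FiniteSet) {P : Pred ∣ A ∣ 0ℓ} → Decidable P → (∣ A ∣ → Carrier) → Carrier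
  ∑[ A ∣ P? ] f = foldr (λ x s → f x + s) 0# (filter P? (elements A))

  infix 5 ∑ ∑[_∣_]_
  syntax ∑ A (λ x → e) = ∑[ x ∈ A ] e

  record Distribution (A : FiniteSet) : Set (c ⊔ ℓ₁ ⊔ ℓ₂) where
    field
      prob   : ∣ A ∣ → Carrier
      nonNeg : ∀ x → 0# ≤ prob x
      total  : ∑ A prob ≈ 1#

  open Distribution public

  FullSupport : {A : FiniteSet} → Distribution A → Set (ℓ₁ ⊔ ℓ₂)
  FullSupport d = ∀ x → 0# < prob d x

  record BalancedRealization (𝐁 : Structure) : Set (c ⊔ ℓ₁ ⊔ ℓ₂) where
    open Structure 𝐁
    field
      π         : ∀ s → Distribution (Domain s)
      π-support : ∀ s → FullSupport (π s)
      μ         : ∀ R → Distribution (Rel R)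
      μ-support : ∀ R → FullSupport (μ R)
      marginal  : ∀ R (j : Fin (arity R)) a →
        ∑[ Rel R ∣ (λ b → value b $ j ≟[ Domain (sig R j) ] a) ] prob (μ R)
          ≈ prob (π (sig R j)) a

------------------------------------------------------------------------
-- Linear programs

  data Sense : Set where
    maximise minimise : Sense

  AtLeastAsGood : Sense → Carrier → Carrier → Set ℓ₂
  AtLeastAsGood maximise u v = v ≤ u
  AtLeastAsGood minimise u v = u ≤ v

  record Problem (V : FiniteSet) : Set (c ⊔ lsuc ℓ₂) where
    field
      sense     : Sense
      Feasible  : (∣ V ∣ → Carrier) → Set ℓ₂
      objective : (∣ V ∣ → Carrier) → Carrier

    -- A relation rather than a function: a problem may be infeasible or
    -- unbounded (with no constraints and no variables, the objective of the
    -- noncontextual fraction is a single unrestricted weight).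
    IsOptimalValue : Carrier → Set (c ⊔ ℓ₁ ⊔ ℓ₂)
    IsOptimalValue v =
      (∃ λ x → Feasible x × objective x ≈ v)
      × (∀ x → Feasible x → AtLeastAsGood sense v (objective x))

  open Problem public

  infix 4 _≋_
  record _≋_ {V : FiniteSet} (P Q : Problem V) : Set (c ⊔ ℓ₁ ⊔ ℓ₂) where
    field
      sense≡     : sense P ≡ sense Q
      feasible⇔  : ∀ x → Feasible P x ⇔ Feasible Q x
      objective≈ : ∀ x → objective P x ≈ objective Q x

  -- max cost·x  subject to  matrix x ≤ bound,  x ≥ 0
  record LinearProgram (V R : FiniteSet) : Set c where
    field
      matrix : ∣ R ∣ → ∣ V ∣ → Carrier
      bound  : ∣ R ∣ → Carrier
      cost   : ∣ V ∣ → Carrier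

    primal : Problem V
    primal = record
      { sense     = maximise
      ; Feasible  = λ x → (∀ r → ∑[ v ∈ V ] matrix r v * x v ≤ bound r) × (∀ v → 0# ≤ x v)
      ; objective = λ x → ∑[ v ∈ V ] cost v * x v
      }

    dual : Problem R
    dual = record
      { sense     = minimise
      ; Feasible  = λ y → (∀ v → cost v ≤ ∑[ r ∈ R ] matrix r v * y r) × (∀ r → 0# ≤ y r)
      ; objective = λ y → ∑[ r ∈ R ] bound r * y r
      }

  open LinearProgram public

------------------------------------------------------------------------
-- Empirical models

  -- Only the data entering the noncontextual fraction is recorded.
  record EmpiricalModel : Set (lsuc 0ℓ ⊔ c) where
    field
      Observable : FiniteSet
      Outcome    : ∣ Observable ∣ → FiniteSet
      Context    : FiniteSet
      size       : ∣ Context ∣ → ℕ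
      member     : ∀ C → Fin (size C) → ∣ Observable ∣

    LocalOutcome : ∣ Context ∣ → FiniteSet
    LocalOutcome C = Πᶠ (Finᶠ (size C)) (λ i → Outcome (member C i))

    field
      weight : ∀ C → ∣ LocalOutcome C ∣ → Carrier

    Global : FiniteSet
    Global = Πᶠ Observable Outcome

    restrict : ∣ Global ∣ → ∀ C → ∣ LocalOutcome C ∣
    restrict g C = tabulate (λ i → g $ member C i)

  ncfProblem : (e : EmpiricalModel) → Problem (EmpiricalModel.Global e)
  ncfProblem e = record
    { sense     = maximise
    ; Feasible  = λ b →
        (∀ C u → ∑[ Global ∣ (λ g → restrict g C ≟[ LocalOutcome C ] u) ] b ≤ weight C u)
        × (∀ g → 0# ≤ b g)
    ; objective = ∑ Global
    }
    where open EmpiricalModel e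

  -- v is the noncontextual fraction of e.
  IsNCF : EmpiricalModel → Carrier → Set (c ⊔ ℓ₁ ⊔ ℓ₂)
  IsNCF e = IsOptimalValue (ncfProblem e)

------------------------------------------------------------------------
-- The balanced occurrence lift and its linear programs

  module Lift {𝐁 : Structure} (ρ : BalancedRealization 𝐁) (𝐗 : Instance 𝐁) where
    open Structure 𝐁
    open BalancedRealization ρ
    open Instance 𝐗

    Occurrence : FiniteSet
    Occurrence = Σᶠ Constraint (λ c → Finᶠ (arity (rel c)))

    Obs : FiniteSet
    Obs = Variable ⊎ᶠ Occurrence

    pattern central x        = inj₁ (_ , x)
    pattern fresh c j        = inj₂ (c , j)
    pattern occurrence c     = inj₁ c
    pattern consistency c j  = inj₂ (c , j)

    outcome : ∣ Obs ∣ → FiniteSet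
    outcome (inj₁ (s , _)) = Domain s
    outcome (fresh c j)    = Domain (sig (rel c) j)

    Ctx : FiniteSet
    Ctx = Constraint ⊎ᶠ Occurrence

    ctxSize : ∣ Ctx ∣ → ℕ
    ctxSize (occurrence c)    = arity (rel c)
    ctxSize (consistency c j) = 2

    ctxMember : ∀ C → Fin (ctxSize C) → ∣ Obs ∣
    ctxMember (occurrence c)    j          = fresh c j
    ctxMember (consistency c j) zero       = central (scope c j)
    ctxMember (consistency c j) (suc zero) = fresh c j

    ctxTable : ∀ C → Π (Finᶠ (ctxSize C)) (λ i → outcome (ctxMember C i)) → Carrier
    ctxTable (occurrence c) u with holds? (rel c) u
    ... | yes p = prob (μ (rel c)) (u , [ p ])
    ... | no _  = 0#
    ctxTable (consistency c j) u =
      if does (u $ zero ≟[ Domain s ] u $ suc zero) then prob (π s) (u $ zero) else 0#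
      where s = sig (rel c) j

    model : EmpiricalModel
    model = record
      { Observable = Obs ; Outcome = outcome
      ; Context = Ctx ; size = ctxSize ; member = ctxMember ; weight = ctxTable }

    open EmpiricalModel model public using (Global; LocalOutcome; restrict)

    -- The global assignment giving every fresh copy of a variable the value
    -- of that variable.
    extend : ∣ Hom ∣ → ∣ Global ∣
    extend h = tabulate λ where
      (inj₁ (_ , x)) → h ⟨ x ⟩
      (fresh c j)    → h ⟨ scope c j ⟩

    CapacityIndex : FiniteSet
    CapacityIndex = Σᶠ Constraint (λ c → Rel (rel c))

    homProblem : Problem Hom
    homProblem = record
      { sense     = maximise
      ; Feasible  = λ w →
          (∀ c b → ∑[ Hom ∣ (λ h → h ⟪ c ⟫ ≟[ Rel (rel c) ] b) ] w ≤ prob (μ (rel c)) b)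
          × (∀ h → 0# ≤ w h)
      ; objective = ∑ Hom
      }

    -- homProblem in matrix form, from which its dual is formed.
    homProgram : LinearProgram Hom CapacityIndex
    homProgram = record
      { matrix = λ (c , b) h → if does (h ⟪ c ⟫ ≟[ Rel (rel c) ] b) then 1# else 0#
      ; bound  = λ (c , b) → prob (μ (rel c)) b
      ; cost   = λ _ → 1#
      }

    dualProblem : Problem CapacityIndex
    dualProblem = record
      { sense     = minimise
      ; Feasible  = λ y →
          (∀ h → 1# ≤ ∑[ c ∈ Constraint ] y (c , h ⟪ c ⟫)) × (∀ r → 0# ≤ y r)
      ; objective = λ y →
          ∑[ c ∈ Constraint ] ∑[ b ∈ Rel (rel c) ] prob (μ (rel c)) b * y (c , b)
      }

    -- The capacity inequalities of the contexts (x_j , x_j^c) for weights on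
    -- homomorphisms, each h standing for the global assignment extend h; all
    -- other global assignments get weight 0, since some occurrence or
    -- consistency table vanishes on them.
    ConsistencyInequalities : (∣ Hom ∣ → Carrier) → Set ℓ₂
    ConsistencyInequalities w = ∀ c j u → let C = consistency c j in
      ∑[ Hom ∣ (λ h → restrict (extend h) C ≟[ LocalOutcome C ] u) ] w ≤ ctxTable C u

    SingletonCapacities : (∣ Hom ∣ → Carrier) → Set ℓ₂
    SingletonCapacities w = ∀ s (x : ∣ Var s ∣) a →
      ∑[ Hom ∣ (λ h → h ⟨ x ⟩ ≟[ Domain s ] a) ] w ≤ prob (π s) a

{-# OPTIONS --safe #-}

-- A feasible weight on global assignments vanishes at every g for which some
-- table is zero on the restriction of g, and the remaining g are exactly the
-- extensions of homomorphisms. Hence restriction along the injection extend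
-- and pushforward along it translate feasible solutions of the two programs
-- into each other without changing the objective. The consistency and
-- singleton inequalities follow by summing an occurrence inequality over the
-- tuples with a given coordinate and using the marginal condition; this is
-- where the absence of isolated variables enters.

module Submission where

open import Defs
open import Algebra.Properties.CommutativeSemigroup using (interchange)
open import Data.Bool.Base using (true; false; if_then_else_)
open import Data.Empty using (⊥-elim-irr)
open import Data.Fin.Base using (zero; suc)
open import Data.Irrelevant using ([_])
open import Data.List.Base using (List; []; _∷_; foldr; filter; map; _++_)
open import Data.List.Properties using (filter-accept; filter-reject; filter-none)
open import Data.List.Membership.Propositional using (_∈_)
open import Data.List.Membership.Propositional.Properties.WithK using (unique⇒irrelevant)
open import Data.List.Relation.Unary.All as All using (All; []; _∷_)
open import Data.List.Relation.Unary.AllPairs using ([]; _∷_)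
open import Data.List.Relation.Unary.Any as Any using (here; there)
open import Data.List.Relation.Unary.Unique.Propositional using (Unique)
open import Data.Product.Base using (∃; _×_; _,_; proj₁; proj₂)
open import Data.Refinement using (value; value-injective; _,_)
open import Data.Sum.Base using (_⊎_; inj₁; inj₂)
open import Function.Base using (_∘_; id)
open import Function.Bundles using (_⇔_; mk⇔)
open import Level using (0ℓ)
open import Relation.Binary.Bundles using (Poset)
open import Relation.Binary.PropositionalEquality as ≡ using (_≡_; refl; cong; cong₂; subst)
open import Relation.Binary.Structures using (IsTotalOrder)
import Relation.Binary.Reasoning.PartialOrder as PosetReasoning
open import Relation.Nullary using (¬_; Dec; does; yes; no; contradiction)
open import Relation.Unary using (Pred; Decidable)
open import Relation.Unary.Properties using (U?)

-- Extensionality of tables, singleton filters and a finite case split.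

module _ (A : FiniteSet) (B : ∣ A ∣ → FiniteSet) where

  $-tabulate : (f : ∀ x → ∣ B x ∣) → ∀ x → tabulate {A} {B} f $ x ≡ f x
  $-tabulate f x = lookup-tabulate (complete A x)
    where
    lookup-tabulate : ∀ {xs} (p : x ∈ xs) →
                      All.lookup (All.tabulate {xs = xs} (λ {y} _ → f y)) p ≡ f x
    lookup-tabulate (here refl) = refl
    lookup-tabulate (there p)   = lookup-tabulate p

  -- `_$_` reads a table only at the chosen proof `complete A x`, whereas equality of rows needs
  -- agreement at every membership proof. The enumeration is duplicate-free, so these proofs
  -- coincide.
  Π-ext : {f g : Π A B} → (∀ x → f $ x ≡ g $ x) → f ≡ g
  Π-ext {f} {g} f≗g = cong table (row-ext (values f) (values g) λ {x} p →
    subst (λ q → All.lookup (values f) q ≡ All.lookup (values g) q)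
          (unique⇒irrelevant (unique A) (complete A x) p) (f≗g x))
    where
    row-ext : ∀ {xs} (r r′ : All (∣_∣ ∘ B) xs) →
              (∀ {x} (p : x ∈ xs) → All.lookup r p ≡ All.lookup r′ p) → r ≡ r′
    row-ext []      []        _  = refl
    row-ext (_ ∷ r) (_ ∷ r′) eq =
      cong₂ _∷_ (eq (here refl)) (row-ext r r′ (eq ∘ there))

  tabulate-cong : {f g : ∀ x → ∣ B x ∣} → (∀ x → f x ≡ g x) → tabulate {A} {B} f ≡ tabulate g
  tabulate-cong {f} {g} f≗g =
    Π-ext λ x → ≡.trans ($-tabulate f x) (≡.trans (f≗g x) (≡.sym ($-tabulate g x)))

filter-singleton : ∀ {X : Set} {P : Pred X 0ℓ} (P? : Decidable P) {a xs} →
                   Unique xs → a ∈ xs → P a → (∀ {x} → P x → x ≡ a) → filter P? xs ≡ a ∷ []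
filter-singleton P? (x≢ ∷ _) (here refl) Pa only =
  ≡.trans (filter-accept P? Pa)
          (cong (_ ∷_) (filter-none P? (All.map (λ x≢y Py → x≢y (≡.sym (only Py))) x≢)))
filter-singleton P? (x≢ ∷ u) (there a∈xs) Pa only =
  ≡.trans (filter-reject P? (λ Px → All.lookup x≢ a∈xs (only Px)))
          (filter-singleton P? u a∈xs Pa only)

-- Needed because the alternative `Q` will be an equation `≈ 0#` in the field, which is not assumed
-- decidable: the choice made at each element is scanned along the enumeration.
all⊎any : ∀ {p q} (A : FiniteSet) {P : Pred ∣ A ∣ p} {Q : Pred ∣ A ∣ q} →
          (∀ x → P x ⊎ Q x) → (∀ x → P x) ⊎ ∃ Q
all⊎any A P⊎Q with All.decide P⊎Q (elements A)
... | inj₁ all = inj₁ λ x → All.lookup all (complete A x)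
... | inj₂ any = inj₂ (Any.satisfied any)

-- Finite sums in an ordered field.

module Sums {c ℓ₁ ℓ₂} (K : OrderedField c ℓ₁ ℓ₂) where
  open OrderedField K renaming (refl to ≈-refl; sym to ≈-sym; trans to ≈-trans)
  open IsTotalOrder isTotalOrder public
    using (antisym; ≤-respˡ-≈; ≤-respʳ-≈)
    renaming (refl to ≤-refl; trans to ≤-trans; reflexive to ≤-reflexive)
  open Over K

  poset : Poset c ℓ₁ ℓ₂
  poset = record { isPartialOrder = IsTotalOrder.isPartialOrder isTotalOrder }

  open PosetReasoning poset

  +-mono-≤ : ∀ {x y u v} → x ≤ y → u ≤ v → x + u ≤ y + v
  +-mono-≤ {x} {y} {u} {v} x≤y u≤v = begin
    x + u ≤⟨ +-monoˡ-≤ u x≤y ⟩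
    y + u ≈⟨ +-comm y u ⟩
    u + y ≤⟨ +-monoˡ-≤ y u≤v ⟩
    v + y ≈⟨ +-comm v y ⟩
    y + v ∎

  -- Turns a filtered sum into a sum over the whole enumeration, so that the order of summation can
  -- be exchanged. The entries of `matrix homProgram` have this shape with `k = 1#`.
  when : {P : Set} → Dec P → Carrier → Carrier
  when P? k = if does P? then k else 0#

  when-cong : ∀ {P : Set} (P? : Dec P) {x y} → x ≈ y → when P? x ≈ when P? y
  when-cong (yes _) x≈y = x≈y
  when-cong (no _)  _   = ≈-refl

  when-mono : ∀ {P Q : Set} (P? : Dec P) (Q? : Dec Q) → (P → Q) →
              ∀ {x} → 0# ≤ x → when P? x ≤ when Q? x
  when-mono (yes _) (yes _) _   _   = ≤-refl
  when-mono (yes p) (no ¬q) P⇒Q _   = contradiction (P⇒Q p) ¬q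
  when-mono (no _)  (yes _) _   0≤x = 0≤x
  when-mono (no _)  (no _)  _   _   = ≤-refl

  when-comm : ∀ {P Q : Set} (P? : Dec P) (Q? : Dec Q) x →
              when P? (when Q? x) ≈ when Q? (when P? x)
  when-comm (yes _) _       _ = ≈-refl
  when-comm (no _)  (yes _) _ = ≈-refl
  when-comm (no _)  (no _)  _ = ≈-refl

  when-* : ∀ {P : Set} (P? : Dec P) x → when P? 1# * x ≈ when P? x
  when-* (yes _) x = *-identityˡ x
  when-* (no _)  x = zeroˡ x

  module _ {X : Set} where

    sum : List X → (X → Carrier) → Carrier
    sum xs f = foldr (λ x s → f x + s) 0# xs

    sum-cong : ∀ xs {f g} → (∀ x → f x ≈ g x) → sum xs f ≈ sum xs g
    sum-cong []       _   = ≈-refl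
    sum-cong (x ∷ xs) f≈g = +-cong (f≈g x) (sum-cong xs f≈g)

    sum-mono : ∀ xs {f g} → (∀ x → f x ≤ g x) → sum xs f ≤ sum xs g
    sum-mono []       _   = ≤-refl
    sum-mono (x ∷ xs) f≤g = +-mono-≤ (f≤g x) (sum-mono xs f≤g)

    sum-zero : ∀ xs → sum xs (λ _ → 0#) ≈ 0#
    sum-zero []       = ≈-refl
    sum-zero (x ∷ xs) = ≈-trans (+-identityˡ _) (sum-zero xs)

    sum-+ : ∀ xs f g → sum xs (λ x → f x + g x) ≈ sum xs f + sum xs g
    sum-+ []       f g = ≈-sym (+-identityˡ 0#)
    sum-+ (x ∷ xs) f g = ≈-trans (+-congˡ (sum-+ xs f g))
      (interchange +-commutativeSemigroup (f x) (g x) (sum xs f) (sum xs g))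

    sum-when : ∀ xs {P : Set} (P? : Dec P) f → sum xs (λ x → when P? (f x)) ≈ when P? (sum xs f)
    sum-when xs (yes _) f = ≈-refl
    sum-when xs (no _)  f = sum-zero xs

    sum-filter : ∀ xs {P : Pred X 0ℓ} (P? : Decidable P) f →
                 sum (filter P? xs) f ≈ sum xs (λ x → when (P? x) (f x))
    sum-filter []       P? f = ≈-refl
    sum-filter (x ∷ xs) P? f with does (P? x)
    ... | true  = +-congˡ (sum-filter xs P? f)
    ... | false = ≈-trans (sum-filter xs P? f) (≈-sym (+-identityˡ _))

    sum-++ : ∀ xs ys f → sum (xs ++ ys) f ≈ sum xs f + sum ys f
    sum-++ []       ys f = ≈-sym (+-identityˡ _)
    sum-++ (x ∷ xs) ys f = ≈-trans (+-congˡ (sum-++ xs ys f)) (≈-sym (+-assoc _ _ _))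

  sum-map : ∀ {X Y : Set} (g : X → Y) xs f → sum (map g xs) f ≈ sum xs (f ∘ g)
  sum-map g []       f = ≈-refl
  sum-map g (x ∷ xs) f = +-congˡ (sum-map g xs f)

  sum-swap : ∀ {X Y : Set} xs ys (f : X → Y → Carrier) →
             sum xs (λ x → sum ys (f x)) ≈ sum ys (λ y → sum xs (λ x → f x y))
  sum-swap []       ys f = ≈-sym (sum-zero ys)
  sum-swap (x ∷ xs) ys f = ≈-trans (+-congˡ (sum-swap xs ys f)) (≈-sym (sum-+ ys _ _))

  module _ (A : FiniteSet) where

    ∑-cong : ∀ {f g} → (∀ x → f x ≈ g x) → ∑ A f ≈ ∑ A g
    ∑-cong = sum-cong (elements A)

    ∑-filter : ∀ {P : Pred ∣ A ∣ 0ℓ} (P? : Decidable P) f →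
               ∑[ A ∣ P? ] f ≈ ∑[ x ∈ A ] when (P? x) (f x)
    ∑-filter = sum-filter (elements A)

    -- The indicator of `U?` computes to its argument, so the right side of `∑-filter` is already
    -- `∑ A f`.
    ∑-U : ∀ f → ∑[ A ∣ U? ] f ≈ ∑ A f
    ∑-U = ∑-filter U?

    ∑-single : ∀ {P : Pred ∣ A ∣ 0ℓ} (P? : Decidable P) f {a} →
               P a → (∀ {x} → P x → x ≡ a) → ∑[ A ∣ P? ] f ≈ f a
    ∑-single P? f {a} Pa only = ≈-trans
      (reflexive (cong (λ xs → sum xs f)
        (filter-singleton P? (unique A) (complete A a) Pa only)))
      (+-identityʳ (f a))

    ∑-none : ∀ {P : Pred ∣ A ∣ 0ℓ} (P? : Decidable P) f → (∀ x → ¬ P x) → ∑[ A ∣ P? ] f ≈ 0#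
    ∑-none P? f ¬P = reflexive (cong (λ xs → sum xs f)
      (filter-none P? {elements A} (All.tabulate λ {x} _ → ¬P x)))

    module _ {P : Pred ∣ A ∣ 0ℓ} (P? : Decidable P) where

      ∑-filter-cong : ∀ {f g} → (∀ x → f x ≈ g x) → ∑[ A ∣ P? ] f ≈ ∑[ A ∣ P? ] g
      ∑-filter-cong = sum-cong (filter P? (elements A))

      ∑-filter-mono : ∀ {f g} → (∀ x → f x ≤ g x) → ∑[ A ∣ P? ] f ≤ ∑[ A ∣ P? ] g
      ∑-filter-mono = sum-mono (filter P? (elements A))

    -- The additional terms are nonnegative. It also rewrites the condition of a filter inside an
    -- upper bound, where one implication suffices.
    ∑-⊆ : ∀ {P Q : Pred ∣ A ∣ 0ℓ} (P? : Decidable P) (Q? : Decidable Q) {f} →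
          (∀ x → 0# ≤ f x) → (∀ x → P x → Q x) → ∑[ A ∣ P? ] f ≤ ∑[ A ∣ Q? ] f
    ∑-⊆ P? Q? {f} 0≤f P⊆Q = begin
      ∑[ A ∣ P? ] f                  ≈⟨ ∑-filter P? f ⟩
      ∑[ x ∈ A ] when (P? x) (f x)   ≤⟨ sum-mono (elements A) (λ x → when-mono (P? x) (Q? x) (P⊆Q x) (0≤f x)) ⟩
      ∑[ x ∈ A ] when (Q? x) (f x)   ≈⟨ ∑-filter Q? f ⟨
      ∑[ A ∣ Q? ] f                  ∎

    ∑-nonNeg : ∀ {P : Pred ∣ A ∣ 0ℓ} (P? : Decidable P) {f} → (∀ x → 0# ≤ f x) → 0# ≤ ∑[ A ∣ P? ] f
    ∑-nonNeg P? 0≤f = ≤-respˡ-≈ (sum-zero (filter P? (elements A))) (∑-filter-mono P? 0≤f)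

    term≤∑ : ∀ {P : Pred ∣ A ∣ 0ℓ} (P? : Decidable P) {f} →
             (∀ x → 0# ≤ f x) → ∀ {a} → P a → f a ≤ ∑[ A ∣ P? ] f
    term≤∑ P? {f} 0≤f {a} Pa = begin
      f a                             ≈⟨ ∑-single (λ x → x ≟[ A ] a) f refl id ⟨
      ∑[ A ∣ (λ x → x ≟[ A ] a) ] f   ≤⟨ ∑-⊆ (λ x → x ≟[ A ] a) P? 0≤f (λ { _ refl → Pa }) ⟩
      ∑[ A ∣ P? ] f                   ∎

  ∑-Σ : ∀ A (B : ∣ A ∣ → FiniteSet) f →
        ∑ (Σᶠ A B) f ≈ ∑[ x ∈ A ] ∑[ y ∈ B x ] f (x , y)
  ∑-Σ A B f = sum-pairs (elements A)
    where
    sum-pairs : ∀ xs → sum (pairs A B xs) f ≈ sum xs (λ x → ∑[ y ∈ B x ] f (x , y))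
    sum-pairs []       = ≈-refl
    sum-pairs (x ∷ xs) = ≈-trans (sum-++ (map (x ,_) (elements (B x))) _ f)
      (+-cong (sum-map (x ,_) (elements (B x)) f) (sum-pairs xs))

  -- Pushforward of weights along a map.

  module _ (A B : FiniteSet) (f : ∣ A ∣ → ∣ B ∣) where

    pushforward : (∣ A ∣ → Carrier) → ∣ B ∣ → Carrier
    pushforward w b = ∑[ A ∣ (λ a → f a ≟[ B ] b) ] w

    -- The fibres of `f` partition `A`: after exchanging the two sums, each `a` contributes only at
    -- `b = f a`.
    ∑-pushforward-filter : ∀ {P : Pred ∣ B ∣ 0ℓ} (P? : Decidable P) w →
                           ∑[ B ∣ P? ] pushforward w ≈ ∑[ A ∣ (λ a → P? (f a)) ] w
    ∑-pushforward-filter P? w = begin-equality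
      ∑[ B ∣ P? ] pushforward w
        ≈⟨ ∑-filter B P? _ ⟩
      ∑[ b ∈ B ] when (P? b) (pushforward w b)
        ≈⟨ ∑-cong B (λ b → when-cong (P? b) (∑-filter A _ w)) ⟩
      ∑[ b ∈ B ] when (P? b) (∑[ a ∈ A ] when (f a ≟[ B ] b) (w a))
        ≈⟨ ∑-cong B (λ b → sum-when (elements A) (P? b) _) ⟨
      ∑[ b ∈ B ] ∑[ a ∈ A ] when (P? b) (when (f a ≟[ B ] b) (w a))
        ≈⟨ sum-swap (elements B) (elements A) _ ⟩
      ∑[ a ∈ A ] ∑[ b ∈ B ] when (P? b) (when (f a ≟[ B ] b) (w a))
        ≈⟨ ∑-cong A (λ a → ∑-cong B (λ b → when-comm (P? b) (f a ≟[ B ] b) (w a))) ⟩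
      ∑[ a ∈ A ] ∑[ b ∈ B ] when (f a ≟[ B ] b) (when (P? b) (w a))
        ≈⟨ ∑-cong A (λ a → ∑-filter B (λ b → f a ≟[ B ] b) _) ⟨
      ∑[ a ∈ A ] ∑[ B ∣ (λ b → f a ≟[ B ] b) ] (λ b → when (P? b) (w a))
        ≈⟨ ∑-cong A (λ a → ∑-single B _ _ refl ≡.sym) ⟩
      ∑[ a ∈ A ] when (P? (f a)) (w a)
        ≈⟨ ∑-filter A (λ a → P? (f a)) w ⟨
      ∑[ A ∣ (λ a → P? (f a)) ] w ∎

    ∑-pushforward : ∀ w → ∑ B (pushforward w) ≈ ∑ A w
    ∑-pushforward w = begin-equality
      ∑ B (pushforward w)          ≈⟨ ∑-U B _ ⟨
      ∑[ B ∣ U? ] pushforward w    ≈⟨ ∑-pushforward-filter U? w ⟩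
      ∑[ A ∣ U? ] w                ≈⟨ ∑-U A w ⟩
      ∑ A w                        ∎

    -- A weight supported on the image of an injection is recovered from its restriction, since
    -- every nonempty fibre has a single point.
    pushforward-∘ : (∀ {a a′} → f a ≡ f a′ → a ≡ a′) →
                    ∀ w → (∀ b → (∃ λ a → f a ≡ b) ⊎ w b ≈ 0#) →
                    ∀ b → pushforward (w ∘ f) b ≈ w b
    pushforward-∘ f-inj w dichotomy b with dichotomy b
    ... | inj₁ (a , refl) = ∑-single A _ _ refl f-inj
    -- The two alternatives may overlap, so the fibre over `b` can be nonempty here; its term is
    -- then `w b` itself, which vanishes.
    ... | inj₂ wb≈0       = begin-equality
      pushforward (w ∘ f) b       ≈⟨ ∑-filter A _ _ ⟩
      ∑[ a ∈ A ] when (f a ≟[ B ] b) (w (f a))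
                                  ≈⟨ ∑-cong A vanish ⟩
      ∑[ a ∈ A ] 0#               ≈⟨ sum-zero (elements A) ⟩
      0#                          ≈⟨ wb≈0 ⟨
      w b                         ∎
      where
      vanish : ∀ a → when (f a ≟[ B ] b) (w (f a)) ≈ 0#
      vanish a with f a ≟[ B ] b
      ... | yes refl = wb≈0
      ... | no _     = ≈-refl

-- Coordinates and supports in the occurrence lift.

module LiftProperties {c ℓ₁ ℓ₂} (K : OrderedField c ℓ₁ ℓ₂) {𝐁 : Structure}
    (ρ : Over.BalancedRealization K 𝐁) (𝐗 : Instance 𝐁) where
  open OrderedField K hiding (zero) renaming (refl to ≈-refl; sym to ≈-sym; trans to ≈-trans)
  open Over K
  open Sums K
  open PosetReasoning poset
  open Structure 𝐁
  open BalancedRealization ρ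
  open Instance 𝐗
  open Lift ρ 𝐗

  image-$ : ∀ h c j → image h c $ j ≡ h $ (_ , scope c j)
  image-$ h c = $-tabulate (Finᶠ (arity (rel c))) (λ j → Domain (sig (rel c) j)) _

  restrict-$ : ∀ g C i → restrict g C $ i ≡ g $ ctxMember C i
  restrict-$ g C = $-tabulate (Finᶠ (ctxSize C)) (λ i → outcome (ctxMember C i)) _

  extend-central : ∀ h {s} (x : ∣ Var s ∣) → extend h $ central x ≡ h ⟨ x ⟩
  extend-central h x = $-tabulate Obs outcome _ (central x)

  extend-fresh : ∀ h c j → extend h $ fresh c j ≡ h ⟨ scope c j ⟩
  extend-fresh h c j = $-tabulate Obs outcome _ (fresh c j)

  -- The central observables already record every value of `h`, and the proof of being a
  -- homomorphism is irrelevant.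
  extend-injective : ∀ {h h′} → extend h ≡ extend h′ → h ≡ h′
  extend-injective {h} {h′} eq = value-injective (Π-ext Variable (λ (s , _) → Domain s) λ (_ , x) →
    ≡.trans (≡.sym (extend-central h x))
      (≡.trans (cong (λ g → g $ central x) eq) (extend-central h′ x)))

  restrict-extend-occurrence : ∀ h c → restrict (extend h) (occurrence c) ≡ value (h ⟪ c ⟫)
  restrict-extend-occurrence h c = tabulate-cong _ _ (extend-fresh h c)

  ctxTable-holds : ∀ c (b : ∣ Rel (rel c) ∣) →
                   ctxTable (occurrence c) (value b) ≡ prob (μ (rel c)) b
  ctxTable-holds c (u , [ p ]) with holds? (rel c) u
  -- Membership proofs are irrelevant, so the proof found by `holds?` and `p` give the same element
  -- of `Rel`.
  ... | yes _ = refl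
  ... | no ¬p = ⊥-elim-irr (¬p p)

  -- A support condition phrased through outcomes, which can be decided, rather than through the
  -- table being nonzero in the field.
  Compatible : ∣ Global ∣ → Pred ∣ Ctx ∣ 0ℓ
  Compatible g (occurrence c)    = Holds (rel c) (restrict g (occurrence c))
  Compatible g (consistency c j) = g $ central (scope c j) ≡ g $ fresh c j

  compatible⊎vanishes : ∀ g C → Compatible g C ⊎ ctxTable C (restrict g C) ≈ 0#
  compatible⊎vanishes g (occurrence c) with holds? (rel c) (restrict g (occurrence c))
  ... | yes p = inj₁ p
  ... | no _  = inj₂ ≈-refl
  compatible⊎vanishes g C@(consistency c j)
    with restrict g C $ zero ≟[ Domain (sig (rel c) j) ] restrict g C $ suc zero
  ... | yes p = inj₁ (≡.trans (≡.sym (restrict-$ g C zero)) (≡.trans p (restrict-$ g C (suc zero))))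
  ... | no _  = inj₂ ≈-refl

  core : ∣ Global ∣ → ∣ Assignment ∣
  core g = tabulate λ (_ , x) → g $ central x

  core-$ : ∀ g {s} (x : ∣ Var s ∣) → core g $ (s , x) ≡ g $ central x
  core-$ g x = $-tabulate Variable (λ (s , _) → Domain s) _ (_ , x)

  -- The consistency contexts force each fresh copy to carry the value of its variable, so `g` is
  -- determined by `core g`; the occurrence contexts then say that `core g` is a homomorphism.
  compatible⇒extend : ∀ g → (∀ C → Compatible g C) → ∃ λ h → extend h ≡ g
  compatible⇒extend g compatible = h , Π-ext Obs outcome extend≗g
    where
    copies-agree : ∀ c j → core g $ (_ , scope c j) ≡ g $ fresh c j
    copies-agree c j = ≡.trans (core-$ g (scope c j)) (compatible (consistency c j))

    h : ∣ Hom ∣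
    h = core g , [ (λ c → subst (Holds (rel c)) (≡.sym (tabulate-cong _ _ (copies-agree c)))
                                (compatible (occurrence c))) ]

    extend≗g : ∀ o → extend h $ o ≡ g $ o
    extend≗g (central x) = ≡.trans (extend-central h x) (core-$ g x)
    extend≗g (fresh c j) = ≡.trans (extend-fresh h c j) (copies-agree c j)

  -- From weights on global assignments to weights on homomorphisms.

  module _ {b : ∣ Global ∣ → Carrier} (feasible : Feasible (ncfProblem model) b) where

    -- If some table is zero at the restriction of `g`, then `b g` is one term of a nonnegative sum
    -- bounded by that zero.
    extend⊎vanishes : ∀ g → (∃ λ h → extend h ≡ g) ⊎ b g ≈ 0#
    extend⊎vanishes g with all⊎any Ctx (compatible⊎vanishes g)
    ... | inj₁ compatible        = inj₁ (compatible⇒extend g compatible)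
    ... | inj₂ (C , table-zero) = inj₂ (antisym (begin
      b g
        ≤⟨ term≤∑ Global (λ g′ → restrict g′ C ≟[ LocalOutcome C ] restrict g C)
                  (proj₂ feasible) refl ⟩
      ∑[ Global ∣ (λ g′ → restrict g′ C ≟[ LocalOutcome C ] restrict g C) ] b
        ≤⟨ proj₁ feasible C (restrict g C) ⟩
      ctxTable C (restrict g C)
        ≈⟨ table-zero ⟩
      0# ∎) (proj₂ feasible g))

    pushforward-extend : ∀ g → pushforward Hom Global extend (b ∘ extend) g ≈ b g
    pushforward-extend = pushforward-∘ Hom Global extend extend-injective b extend⊎vanishes

    ncf-feasible⇒hom-feasible : Feasible homProblem (b ∘ extend)
    ncf-feasible⇒hom-feasible = capacity , proj₂ feasible ∘ extend
      where
      capacity : ∀ c t → ∑[ Hom ∣ (λ h → h ⟪ c ⟫ ≟[ Rel (rel c) ] t) ] (b ∘ extend) ≤ prob (μ (rel c)) t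
      capacity c t = begin
        ∑[ Hom ∣ (λ h → h ⟪ c ⟫ ≟[ Rel (rel c) ] t) ] (b ∘ extend)
          ≤⟨ ∑-⊆ Hom _ (λ h → R? (extend h)) (proj₂ feasible ∘ extend)
                 (λ { h refl → restrict-extend-occurrence h c }) ⟩
        ∑[ Hom ∣ (λ h → R? (extend h)) ] (b ∘ extend)
          -- Moves the sum back to `Global`, where the pushforward of the restricted weight is `b`
          -- itself.
          ≈⟨ ∑-pushforward-filter Hom Global extend R? (b ∘ extend) ⟨
        ∑[ Global ∣ R? ] pushforward Hom Global extend (b ∘ extend)
          ≈⟨ ∑-filter-cong Global R? pushforward-extend ⟩
        ∑[ Global ∣ R? ] b
          ≤⟨ proj₁ feasible C (value t) ⟩
        ctxTable C (value t)
          ≡⟨ ctxTable-holds c t ⟩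
        prob (μ (rel c)) t ∎
        where
        C = occurrence c
        R? : Decidable (λ g → restrict g C ≡ value t)
        R? g = restrict g C ≟[ LocalOutcome C ] value t

    ∑-extend : ∑ Hom (b ∘ extend) ≈ ∑ Global b
    ∑-extend = begin-equality
      ∑ Hom (b ∘ extend)
        ≈⟨ ∑-pushforward Hom Global extend (b ∘ extend) ⟨
      ∑ Global (pushforward Hom Global extend (b ∘ extend))
        ≈⟨ ∑-cong Global pushforward-extend ⟩
      ∑ Global b ∎

  -- From weights on homomorphisms to weights on global assignments.

  module _ {w : ∣ Hom ∣ → Carrier} (feasible : Feasible homProblem w) where

    -- The left side of each capacity inequality is the pushforward of `w` along `_⟪ c ⟫`, so adding
    -- the inequalities over the tuples in `P` gives the bound.
    capacity-filter : ∀ c {P : Pred ∣ Rel (rel c) ∣ 0ℓ} (P? : Decidable P) →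
                      ∑[ Hom ∣ (λ h → P? (h ⟪ c ⟫)) ] w ≤ ∑[ Rel (rel c) ∣ P? ] prob (μ (rel c))
    capacity-filter c P? = ≤-respˡ-≈ (∑-pushforward-filter Hom (Rel (rel c)) (_⟪ c ⟫) P? w)
                                     (∑-filter-mono (Rel (rel c)) P? (proj₁ feasible c))

    singletonCapacities : SingletonCapacities w
    singletonCapacities s x a with nonIsolated (s , x)
    -- Matching on `refl` makes `x` the entry `scope c j` and `s` its sort in the signature, so
    -- `marginal` applies at position `j`.
    ... | c , j , refl = begin
      ∑[ Hom ∣ (λ h → h ⟨ scope c j ⟩ ≟[ Domain s ] a) ] w
        ≤⟨ ∑-⊆ Hom _ _ (proj₂ feasible) (λ h → ≡.trans (image-$ (value h) c j)) ⟩
      ∑[ Hom ∣ (λ h → value (h ⟪ c ⟫) $ j ≟[ Domain s ] a) ] w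
        ≤⟨ capacity-filter c (λ t → value t $ j ≟[ Domain s ] a) ⟩
      ∑[ Rel (rel c) ∣ (λ t → value t $ j ≟[ Domain s ] a) ] prob (μ (rel c))
        ≈⟨ marginal (rel c) j a ⟩
      prob (π s) a ∎

    -- On the diagonal the bound is a singleton capacity. Off the diagonal no homomorphism
    -- contributes, because `extend` gives a variable and its copy equal values.
    consistencyInequalities : ConsistencyInequalities w
    consistencyInequalities c j u
      with u $ zero ≟[ Domain (sig (rel c) j) ] u $ suc zero
    ... | yes _    = ≤-trans
      (∑-⊆ Hom _ _ (proj₂ feasible) λ { h refl → ≡.sym (≡.trans
        (restrict-$ (extend h) (consistency c j) zero) (extend-central h (scope c j))) })
      (singletonCapacities _ (scope c j) (u $ zero))
    ... | no u₀≢u₁ = ≤-reflexive (∑-none Hom _ w λ { h refl → u₀≢u₁ (copies-equal h) })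
      where
      C = consistency c j
      copies-equal : ∀ h → restrict (extend h) C $ zero ≡ restrict (extend h) C $ suc zero
      copies-equal h = ≡.trans (restrict-$ (extend h) C zero)
        (≡.trans (extend-central h (scope c j))
          (≡.sym (≡.trans (restrict-$ (extend h) C (suc zero)) (extend-fresh h c j))))

    occurrenceInequalities : ∀ c u → let C = occurrence c in
      ∑[ Hom ∣ (λ h → restrict (extend h) C ≟[ LocalOutcome C ] u) ] w ≤ ctxTable C u
    occurrenceInequalities c u with holds? (rel c) u
    ... | yes p = ≤-trans
      (∑-⊆ Hom _ _ (proj₂ feasible) λ { h refl →
        value-injective (≡.sym (restrict-extend-occurrence h c)) })
      (proj₁ feasible c (u , [ p ]))
    -- The table is zero off the relation, and the sum is empty since every homomorphism sends `c`
    -- into the relation.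
    ... | no ¬p = ≤-reflexive (∑-none Hom _ w λ { h@(_ , [ hom ]) refl →
      ⊥-elim-irr (¬p (subst (Holds (rel c)) (≡.sym (restrict-extend-occurrence h c)) (hom c))) })

    hom-feasible⇒ncf-feasible : Feasible (ncfProblem model) (pushforward Hom Global extend w)
    hom-feasible⇒ncf-feasible =
      (λ C u → ≤-respˡ-≈
        (≈-sym (∑-pushforward-filter Hom Global extend
                  (λ g → restrict g C ≟[ LocalOutcome C ] u) w))
        (inequality C u))
      , λ g → ∑-nonNeg Hom (λ h → extend h ≟[ Global ] g) (proj₂ feasible)
      where
      inequality : ∀ C u →
        ∑[ Hom ∣ (λ h → restrict (extend h) C ≟[ LocalOutcome C ] u) ] w ≤ ctxTable C u
      inequality (occurrence c)    = occurrenceInequalities c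
      inequality (consistency c j) = consistencyInequalities c j

  -- In each direction one translation carries the attaining solution across and the other carries
  -- competitors back; both preserve the objective.
  ncf⇔hom : ∀ v → IsNCF model v ⇔ IsOptimalValue homProblem v
  ncf⇔hom v = mk⇔
    (λ ((b , feasible , value≈) , bounded) →
      (b ∘ extend , ncf-feasible⇒hom-feasible feasible , ≈-trans (∑-extend feasible) value≈)
      , λ w feasible′ → ≤-respˡ-≈ (∑-pushforward Hom Global extend w)
                                  (bounded _ (hom-feasible⇒ncf-feasible feasible′)))
    (λ ((w , feasible , value≈) , bounded) →
      (pushforward Hom Global extend w , hom-feasible⇒ncf-feasible feasible
        , ≈-trans (∑-pushforward Hom Global extend w) value≈)
      , λ b feasible′ → ≤-respˡ-≈ (∑-extend feasible′)
                                  (bounded _ (ncf-feasible⇒hom-feasible feasible′)))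

  -- Matrix form of the homomorphism program and its dual.

  primal≋homProblem : primal homProgram ≋ homProblem
  primal≋homProblem = record
    { sense≡     = refl
    ; feasible⇔  = λ w → mk⇔
        (λ (capacity , 0≤w) → (λ c b → ≤-respˡ-≈ (row w c b) (capacity (c , b))) , 0≤w)
        (λ (capacity , 0≤w) → (λ (c , b) → ≤-respˡ-≈ (≈-sym (row w c b)) (capacity c b)) , 0≤w)
    ; objective≈ = λ w → ∑-cong Hom (λ h → *-identityˡ (w h))
    }
    where
    row : ∀ w c b → ∑[ h ∈ Hom ] matrix homProgram (c , b) h * w h
                    ≈ ∑[ Hom ∣ (λ h → h ⟪ c ⟫ ≟[ Rel (rel c) ] b) ] w
    row w c b = ≈-trans (∑-cong Hom (λ h → when-* (h ⟪ c ⟫ ≟[ Rel (rel c) ] b) (w h)))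
                        (≈-sym (∑-filter Hom _ w))

  dual≋dualProblem : dual homProgram ≋ dualProblem
  dual≋dualProblem = record
    { sense≡     = refl
    ; feasible⇔  = λ y → mk⇔
        (λ (cover , 0≤y) → (λ h → ≤-respʳ-≈ (column y h) (cover h)) , 0≤y)
        (λ (cover , 0≤y) → (λ h → ≤-respʳ-≈ (≈-sym (column y h)) (cover h)) , 0≤y)
    ; objective≈ = λ y → ∑-Σ Constraint (λ c → Rel (rel c)) _
    }
    where
    -- For each constraint `c`, the column of `h` has exactly one entry `1#`, at `b = h ⟪ c ⟫`, so
    -- the inner sum collapses to a single dual variable.
    column : ∀ y h → ∑[ r ∈ CapacityIndex ] matrix homProgram r h * y r
                     ≈ ∑[ c ∈ Constraint ] y (c , h ⟪ c ⟫)
    column y h = begin-equality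
      ∑[ r ∈ CapacityIndex ] matrix homProgram r h * y r
        ≈⟨ ∑-Σ Constraint (λ c → Rel (rel c)) _ ⟩
      ∑[ c ∈ Constraint ] ∑[ b ∈ Rel (rel c) ] matrix homProgram (c , b) h * y (c , b)
        ≈⟨ ∑-cong Constraint (λ c → ∑-cong (Rel (rel c)) (λ b →
             when-* (h ⟪ c ⟫ ≟[ Rel (rel c) ] b) (y (c , b)))) ⟩
      ∑[ c ∈ Constraint ] ∑[ b ∈ Rel (rel c) ] when (h ⟪ c ⟫ ≟[ Rel (rel c) ] b) (y (c , b))
        ≈⟨ ∑-cong Constraint (λ c → ∑-filter (Rel (rel c)) (λ b → h ⟪ c ⟫ ≟[ Rel (rel c) ] b) _) ⟨
      ∑[ c ∈ Constraint ] ∑[ Rel (rel c) ∣ (λ b → h ⟪ c ⟫ ≟[ Rel (rel c) ] b) ] (λ b → y (c , b))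
        ≈⟨ ∑-cong Constraint (λ c → ∑-single (Rel (rel c)) _ _ refl ≡.sym) ⟩
      ∑[ c ∈ Constraint ] y (c , h ⟪ c ⟫) ∎

proposition2p3 : ∀ {c ℓ₁ ℓ₂} (K : OrderedField c ℓ₁ ℓ₂) {𝐁 : Structure}
    (ρ : Over.BalancedRealization K 𝐁) (𝐗 : Instance 𝐁) →
    let open Over K
        open Lift ρ 𝐗 in
    (∀ v → IsNCF model v ⇔ IsOptimalValue homProblem v)
    × (∀ w → Feasible homProblem w → ConsistencyInequalities w × SingletonCapacities w)
    × (primal homProgram ≋ homProblem × dual homProgram ≋ dualProblem)
proposition2p3 K ρ 𝐗 =
  ncf⇔hom
  , (λ w feasible → consistencyInequalities feasible , singletonCapacities feasible)
  , primal≋homProblem , dual≋dualProblem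
  where open LiftProperties K ρ 𝐗
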